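{- Let $G,H$ be two colored prime graphs of twin-width at most $1$ such that $G\not\cong H$ (as colored graphs). Then the $3$-dimensional Weisfeiler-Leman algorithm distinguishes $G$ and $H$.
   Context: All graphs are finite and simple. A colored graph is a graph with a vertex coloring $c:V(G)\to\mathbb{N}$; isomorphisms preserve colors; twin-width of a colored graph is that of its underlying graph (defined via partition sequences: merge two parts at a time starting from singletons; in the quotient trigraph two parts are joined by a red edge if they are neither fully adjacent nor fully non-adjacent; width = max red degree; twin-width = min width). A module is a vertex set $M$ such that every vertex outside $M$ is adjacent to all or none of $M$; $G$ is prime if its only modules are singletons and $V(G)$. For colored graphs, the $k$-dimensional Weisfeiler-Leman algorithm starts from the atomic type of each $k$-tuple (including the colors of its entries, equalities and adjacencies) and refines by $\chi^{i+1}(\vec v)=(\chi^i(\vec v),\{\!\{(\mathrm{atp}(\vec v w),\chi^i(\vec v[w/1]),\dots,\chi^i(\vec v[w/k])):w\in V(G)\}\!\})$ until stable; it distinguishes $G,H$ if some stable color has different multiplicities in $V(G)^k$ and $V(H)^k$. -}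

module Defs where

open import Data.Nat using (ℕ; zero; suc; _≤_; _+_)
open import Data.Bool using (Bool; true; false; _∧_; _∨_; not; if_then_else_)
open import Data.Fin using (Fin; zero; suc; _≟_)
open import Data.Vec using (Vec; lookup; _∷ʳ_; _[_]≔_)
open import Data.Product using (Σ; _×_; _,_; ∃)
open import Data.Sum using (_⊎_)
open import Function using (id)
open import Function.Bundles using (_↔_; Inverse; _⇔_)
open import Relation.Binary.PropositionalEquality using (_≡_; _≢_)
open import Relation.Nullary using (¬_; does)

record CGraph : Set where
  field
    n      : ℕ
    adj    : Fin n → Fin n → Bool
    sym    : ∀ u v → adj u v ≡ adj v u
    irrefl : ∀ v → adj v v ≡ false
    col    : Fin n → ℕ

open CGraph public

V : CGraph → Set
V G = Fin (n G)

_≅_ : CGraph → CGraph → Set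
G ≅ H = Σ (V G ↔ V H) λ f →
          (∀ u v → adj H (Inverse.to f u) (Inverse.to f v) ≡ adj G u v)
        × (∀ u → col H (Inverse.to f u) ≡ col G u)

IsModule : (G : CGraph) → (V G → Bool) → Set
IsModule G M = ∀ x → M x ≡ false → ∀ u v → M u ≡ true → M v ≡ true →
               adj G x u ≡ adj G x v

Prime : CGraph → Set
Prime G = ∀ M → IsModule G M →
            (∀ v → M v ≡ false)
          ⊎ (Σ (V G) λ v → ∀ u → (M u ≡ true) ⇔ (u ≡ v))
          ⊎ (∀ v → M v ≡ true)

-- Twin-width via partition sequences.
-- A partition into k parts is given by a labelling p : V G → Fin k
-- (vertex x lies in part p x).

anyF : ∀ {k} → (Fin k → Bool) → Bool
anyF {zero}  f = false
anyF {suc k} f = f zero ∨ anyF (λ i → f (suc i))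

countF : ∀ {k} → (Fin k → Bool) → ℕ
countF {zero}  f = 0
countF {suc k} f = (if f zero then 1 else 0) + countF (λ i → f (suc i))

eqF : ∀ {k} → Fin k → Fin k → Bool
eqF i j = does (i ≟ j)

red : (G : CGraph) {k : ℕ} → (V G → Fin k) → Fin k → Fin k → Bool
red G p i j =
  not (eqF i j)
  ∧ anyF (λ x → anyF (λ y → eqF (p x) i ∧ eqF (p y) j ∧ adj G x y))
  ∧ anyF (λ x → anyF (λ y → eqF (p x) i ∧ eqF (p y) j ∧ not (adj G x y)))

redDeg : (G : CGraph) {k : ℕ} → (V G → Fin k) → Fin k → ℕ
redDeg G p i = countF (λ j → red G p i j)

Width≤ : (G : CGraph) {k : ℕ} → (V G → Fin k) → ℕ → Set
Width≤ G p d = ∀ i → redDeg G p i ≤ d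

Merge : (G : CGraph) {k : ℕ} → (V G → Fin (suc k)) → (V G → Fin k) → Set
Merge G p q = Σ (Fin _) λ a → Σ (Fin _) λ b → a ≢ b ×
  (∀ u v → (q u ≡ q v) ⇔
     (p u ≡ p v ⊎ (p u ≡ a × p v ≡ b) ⊎ (p u ≡ b × p v ≡ a)))

data Seq (G : CGraph) (d : ℕ) : (k : ℕ) → (V G → Fin k) → Set where
  end  : ∀ {k} (p : V G → Fin k) → k ≤ 1 → Seq G d k p
  step : ∀ {k} (p : V G → Fin (suc k)) (q : V G → Fin k) →
         Merge G p q → Width≤ G q d → Seq G d k q → Seq G d (suc k) p

-- twin-width ≤ d: a sequence starting from the partition into singletons
-- (whose quotient has no red edges) with every partition of width ≤ d
TwinWidth≤ : CGraph → ℕ → Set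
TwinWidth≤ G d = Seq G d (n G) id

-- k-dimensional Weisfeiler-Leman.  Colours are compared across graphs:
-- WLeq k i G H u v  means  χ^i(u) = χ^i(v)  for u ∈ V(G)^k, v ∈ V(H)^k.

SameAtp : (G H : CGraph) {m : ℕ} → Vec (V G) m → Vec (V H) m → Set
SameAtp G H u v =
    (∀ i → col G (lookup u i) ≡ col H (lookup v i))
  × (∀ i j → (lookup u i ≡ lookup u j) ⇔ (lookup v i ≡ lookup v j))
  × (∀ i j → adj G (lookup u i) (lookup u j) ≡ adj H (lookup v i) (lookup v j))

-- equality of the multisets {{(atp(u w), χ^i(u[w/1]), …, χ^i(u[w/k])) : w}}
-- is witnessed by a bijection V(G) ↔ V(H) matching equal entries
WLeq : (k i : ℕ) (G H : CGraph) → Vec (V G) k → Vec (V H) k → Set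
WLeq k zero    G H u v = SameAtp G H u v
WLeq k (suc i) G H u v =
  WLeq k i G H u v ×
  Σ (V G ↔ V H) λ f → ∀ w →
      SameAtp G H (u ∷ʳ w) (v ∷ʳ Inverse.to f w)
    × (∀ j → WLeq k i G H (u [ j ]≔ w) (v [ j ]≔ Inverse.to f w))

StableAt : (k i : ℕ) (G H : CGraph) → Set
StableAt k i G H = Stab G G × Stab G H × Stab H G × Stab H H
  where
  Stab : CGraph → CGraph → Set
  Stab X Y = ∀ u v → WLeq k i X Y u v → WLeq k (suc i) X Y u v

SameMultiset : (k i : ℕ) (G H : CGraph) → Set
SameMultiset k i G H =
  Σ (Vec (V G) k ↔ Vec (V H) k) λ g → ∀ s → WLeq k i G H s (Inverse.to g s)

WLDistinguishes : (k : ℕ) (G H : CGraph) → Set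
WLDistinguishes k G H = Σ ℕ λ i → StableAt k i G H × ¬ SameMultiset k i G H

{-# OPTIONS --safe #-}
-- Let u and v be the first two vertices merged in a 1-contraction sequence of G. Individualising
-- u and v makes the stable colouring of G discrete. Indeed, follow the red edge AB that this merge
-- creates: by primality a non-singleton part always has a red neighbour, so width 1 leaves only two
-- ways to enlarge A ∪ B. Either A absorbs a single vertex x, which is then homogeneous with A outside
-- A ∪ B ∪ {x}, so that another vertex of the same colour would be a twin of x; or A and B are merged,
-- and a single vertex z distinguishes A from B, which determines z. Either way, A ∪ B keeps consisting
-- of vertices with unique colours until it is everything.
--
-- The 3-dimensional algorithm on the triples (u , v , x) refines this colouring, so a triple of H
-- equivalent to one of G yields an isomorphism.
module Submission where

open import Defs
open import Relation.Nullary using (¬_; Dec; yes; no; does; contradiction)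
open import Data.Bool using (Bool; true; false; _∧_; not; if_then_else_)
import Data.Bool.Properties as Bool
open import Data.Fin using (Fin; zero; suc; _≟_; #_)
open import Data.Fin.Properties using (all?; any?)
open import Data.List using
  (List; []; _∷_; _++_; map; filter; length; cartesianProduct; cartesianProductWith; allFin)
open import Data.List.Membership.Propositional using (_∈_)
open import Data.List.Membership.Propositional.Properties using
  (∈-filter⁺; ∈-cartesianProductWith⁺; ∈-cartesianProduct⁺; ∈-allFin; ∈-map⁺; ∈-++⁺ˡ; ∈-++⁺ʳ)
open import Data.List.Properties using (filter-notAll)
import Data.List.Relation.Unary.All as All
open import Data.List.Relation.Unary.All.Properties using (¬All⇒Any¬)
open import Data.List.Relation.Unary.Any using (here)
open import Data.Nat as ℕ using (ℕ; zero; suc; _≤_; _<_; z≤n; s≤s)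
open import Data.Nat.Induction using (<-wellFounded; Acc; acc)
open import Data.Nat.Properties using (≤-trans; m≤n+m)
open import Data.Product using (Σ; ∃; ∃-syntax; _×_; _,_; proj₁; proj₂)
open import Data.Sum using (_⊎_; inj₁; inj₂; [_,_]′)
open import Data.Vec using (Vec; []; _∷_; head; _∷ʳ_; _[_]≔_)
open import Function using (_∘_)
open import Function.Bundles using (_↔_; _⇔_; Inverse; Equivalence; mk⇔; mk↔ₛ′)
open import Function.Construct.Composition using (_↔-∘_)
open import Function.Construct.Symmetry using (↔-sym)
open import Relation.Binary.PropositionalEquality
  using (_≡_; _≢_; _≗_; refl; trans; cong; cong₂; subst; module ≡-Reasoning)
  renaming (sym to ≡-sym)
open import Relation.Nullary.Decidable
  using (_×-dec_; _⊎-dec_; _→-dec_; ¬?; map′; decidable-stable; dec-true; dec-false)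
open import Relation.Unary using (Decidable)

open Inverse using (to; from; strictlyInverseˡ; strictlyInverseʳ)

-- Finite sets, Boolean reflection and primality

Fin≤1 : ∀ {k} → k ≤ 1 → (i j : Fin k) → i ≡ j
Fin≤1 (s≤s z≤n) zero zero = refl

does-true : ∀ {A : Set} (a? : Dec A) → does a? ≡ true → A
does-true (yes a) _ = a

does-false : ∀ {A : Set} (a? : Dec A) → does a? ≡ false → ¬ A
does-false (no ¬a) _ = ¬a

anyF-intro : ∀ {k} (f : Fin k → Bool) i → f i ≡ true → anyF f ≡ true
anyF-intro f zero    fi rewrite fi = refl
anyF-intro f (suc i) fi rewrite anyF-intro (f ∘ suc) i fi = Bool.∨-zeroʳ (f zero)

countF-positive : ∀ {k} (f : Fin k → Bool) i → f i ≡ true → 1 ≤ countF f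
countF-positive f zero    fi rewrite fi = s≤s z≤n
countF-positive f (suc i) fi = ≤-trans (countF-positive (f ∘ suc) i fi) (m≤n+m _ _)

countF≤1⇒unique : ∀ {k} (f : Fin k → Bool) → countF f ≤ 1 →
                  ∀ i j → f i ≡ true → f j ≡ true → i ≡ j
countF≤1⇒unique f c zero    zero    fi fj = refl
countF≤1⇒unique f c zero    (suc j) fi fj rewrite fi
  with s≤s c′ ← c with () ← ≤-trans (countF-positive (f ∘ suc) j fj) c′
countF≤1⇒unique f c (suc i) zero    fi fj rewrite fj
  with s≤s c′ ← c with () ← ≤-trans (countF-positive (f ∘ suc) i fi) c′
countF≤1⇒unique f c (suc i) (suc j) fi fj =
  cong suc (countF≤1⇒unique (f ∘ suc) (≤-trans (m≤n+m _ _) c) i j fi fj)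

-- If no vertex split `P`, it would be a module with two distinct members that misses `y`. The
-- search is finite, so actual witnesses are obtained.
splitter : ∀ {G} → Prime G → {P : V G → Set} (P? : ∀ x → Dec (P x)) →
           ∀ {x x′ y} → x ≢ x′ → P x → P x′ → ¬ P y →
           ∃[ z ] ∃[ u ] ∃[ v ] (¬ P z × P u × P v × adj G z u ≢ adj G z v)
splitter {G} prime P? {x} {x′} {y} x≢x′ Px Px′ ¬Py
  with any? (λ z → any? λ u → any? λ v →
         ¬? (P? z) ×-dec P? u ×-dec P? v ×-dec ¬? (adj G z u Bool.≟ adj G z v))
... | yes split = split
... | no ¬split with prime (does ∘ P?) (λ z z∉ u v u∈ v∈ →
      decidable-stable (_ Bool.≟ _) λ differ → ¬split
        (z , u , v , does-false (P? z) z∉ , does-true (P? u) u∈ , does-true (P? v) v∈ , differ))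
... | inj₁ empty = contradiction Px (does-false (P? x) (empty x))
... | inj₂ (inj₁ (v , single)) = contradiction
      (trans (Equivalence.to (single x) (dec-true (P? x) Px))
             (≡-sym (Equivalence.to (single x′) (dec-true (P? x′) Px′)))) x≢x′
... | inj₂ (inj₂ full) = contradiction (does-true (P? y) (full y)) ¬Py

-- Red edges and merges

-- Parts are named by representatives: Red G p a b says that the parts of a and b are
-- joined by a red edge of the quotient.
record Red (G : CGraph) {k : ℕ} (p : V G → Fin k) (a b : V G) : Set where
  constructor mkRed
  field
    apart       : p a ≢ p b
    {x y x′ y′} : V G
    x∈a         : p x ≡ p a
    y∈b         : p y ≡ p b
    x′∈a        : p x′ ≡ p a
    y′∈b        : p y′ ≡ p b
    differ      : adj G x y ≢ adj G x′ y′

module _ {G : CGraph} {k : ℕ} {p : V G → Fin k} where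

  Red-sym : ∀ {a b} → Red G p a b → Red G p b a
  Red-sym (mkRed a≢b x y x′ y′ differ) =
    mkRed (a≢b ∘ ≡-sym) y x y′ x′ λ e → differ (trans (sym G _ _) (trans e (sym G _ _)))

  Red-respˡ : ∀ {a a′ b} → p a ≡ p a′ → Red G p a b → Red G p a′ b
  Red-respˡ e (mkRed a≢b x y x′ y′ differ) =
    mkRed (a≢b ∘ trans e) (trans x e) y (trans x′ e) y′ differ

  Red-respʳ : ∀ {a b b′} → p b ≡ p b′ → Red G p a b → Red G p a b′
  Red-respʳ e = Red-sym ∘ Red-respˡ e ∘ Red-sym

  Red-coarsen : ∀ {l} {q : V G → Fin l} → (∀ {u v} → p u ≡ p v → q u ≡ q v) →
                ∀ {a b} → q a ≢ q b → Red G p a b → Red G q a b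
  Red-coarsen c a≢b (mkRed _ x y x′ y′ differ) = mkRed a≢b (c x) (c y) (c x′) (c y′) differ

  private
    witnessed : (c : V G → V G → Bool) {i j : Fin k} → ∀ {x y} → p x ≡ i → p y ≡ j → c x y ≡ true →
                anyF (λ x → anyF (λ y → eqF (p x) i ∧ eqF (p y) j ∧ c x y)) ≡ true
    witnessed c {x = x} {y} refl refl cxy =
      anyF-intro _ x (anyF-intro _ y
        (cong₂ _∧_ (dec-true (p x ≟ p x) refl)
          (cong₂ _∧_ (dec-true (p y ≟ p y) refl) cxy)))

  Red⇒red : ∀ {a b} → Red G p a b → red G p (p a) (p b) ≡ true
  Red⇒red {a} {b} (mkRed a≢b {x} {y} {x′} {y′} x∈a y∈b x′∈a y′∈b differ)
    rewrite dec-false (p a ≟ p b) a≢b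
    with adj G x y in e | adj G x′ y′ in e′
  ... | true  | true  = contradiction refl differ
  ... | false | false = contradiction refl differ
  ... | true  | false = cong₂ _∧_ (witnessed (adj G) x∈a y∈b e)
                          (witnessed (λ x y → not (adj G x y)) x′∈a y′∈b (cong not e′))
  ... | false | true  = cong₂ _∧_ (witnessed (adj G) x′∈a y′∈b e′)
                          (witnessed (λ x y → not (adj G x y)) x∈a y∈b (cong not e))

  -- This is the form in which the width bound enters every later argument.
  Red-unique : Width≤ G p 1 → ∀ {a b c} → Red G p a b → Red G p a c → p b ≡ p c
  Red-unique width {a} ab ac = countF≤1⇒unique (red G p (p a)) (width (p a)) _ _ (Red⇒red ab) (Red⇒red ac)

  -- A splitter of the part of `x` sees two of its members differently, which makes the edge to the
  -- splitter's own part red.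
  prime⇒Red : Prime G → ∀ {x x′ y} → x ≢ x′ → p x′ ≡ p x → p y ≢ p x → ∃[ z ] Red G p x z
  prime⇒Red prime {x} x≢x′ x′∈ y∉ with splitter {G} prime (λ w → p w ≟ p x) x≢x′ refl x′∈ y∉
  ... | z , u , v , z∉ , u∈ , v∈ , differ =
    z , mkRed (z∉ ∘ ≡-sym) u∈ refl v∈ refl λ e → differ (trans (sym G _ _) (trans e (sym G _ _)))

Merge-coarsens : ∀ {G k} {p : V G → Fin (suc k)} {q} → Merge G p q → ∀ {u v} → p u ≡ p v → q u ≡ q v
Merge-coarsens (_ , _ , _ , iff) e = Equivalence.from (iff _ _) (inj₁ e)

-- Distinct parts with the same image under `q` must be the merged pair, in one order or the other,
-- so any representatives `r` and `x` can stand for it.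
Merge-classes : ∀ {G k} {p : V G → Fin (suc k)} {q} → Merge G p q →
                ∀ {r x} → p r ≢ p x → q r ≡ q x → ∀ {u v} → q u ≡ q v →
                p u ≡ p v ⊎ (p u ≡ p r × p v ≡ p x) ⊎ (p u ≡ p x × p v ≡ p r)
Merge-classes (_ , _ , _ , iff) {r} {x} r≢x e {u} {v} uv with Equivalence.to (iff r x) e
... | inj₁ r≡x = contradiction r≡x r≢x
... | inj₂ (inj₁ (refl , refl)) = Equivalence.to (iff u v) uv
... | inj₂ (inj₂ (refl , refl)) with Equivalence.to (iff u v) uv
...   | inj₁ h = inj₁ h
...   | inj₂ (inj₁ h) = inj₂ (inj₂ h)
...   | inj₂ (inj₂ h) = inj₂ (inj₁ h)

-- Equitable relations on a prime graph

Determined : {A : Set} → (A → A → Set) → A → Set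
Determined E x = ∀ {x′} → E x x′ → x ≡ x′

-- E is thought of as "having the same stable colour after individualising u and v".
record Equitable (G : CGraph) (u v : V G) (E : V G → V G → Set) : Set where
  field
    symmetric    : ∀ {x y} → E x y → E y x
    extend       : ∀ {x x′} → E x x′ → Σ (V G ↔ V G) λ g → ∀ w →
                   adj G x w ≡ adj G x′ (to g w) × (x ≡ w → x′ ≡ to g w) × E w (to g w)
    determined-u : Determined E u
    determined-v : Determined E v

module _ {G : CGraph} {u v : V G} {E : V G → V G → Set} (equitable : Equitable G u v E) where
  open Equitable equitable

  private
    Det : V G → Set
    Det = Determined E

  -- The bijection of `extend` sends `s` to an `E`-related vertex, hence to `s` itself.
  same-adj : ∀ {x x′ s} → E x x′ → Det s → adj G x s ≡ adj G x′ s
  same-adj {x} {x′} {s} Exx′ det with g , ext ← extend Exx′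
    with adj≡ , _ , Es ← ext s = trans adj≡ (cong (adj G x′) (≡-sym (det Es)))

  -- A vertex x′ of the same colour as x would be a twin of x.
  twin-determined : Prime G → {P : V G → Set} → (∀ w → Dec (P w)) → (∀ {s} → P s → Det s) →
                    ∀ {a x} → P a → ¬ P x →
                    (∀ {y} → ¬ P y → y ≢ x → adj G y a ≡ adj G y x) → Det x
  twin-determined prime {P} P? det {a} {x} Pa ¬Px similar {x′} Exx′ =
    decidable-stable (x ≟ x′) λ x≢x′ →
      let z , s , t , z∉ , s∈ , t∈ , differ =
            splitter {G} prime (λ w → (w ≟ x) ⊎-dec (w ≟ x′)) x≢x′ (inj₁ refl) (inj₂ refl) a∉
      in differ (trans (toX z∉ s∈) (≡-sym (toX z∉ t∈)))
    where
    a∉ : ¬ (a ≡ x ⊎ a ≡ x′)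
    a∉ (inj₁ refl) = ¬Px Pa
    a∉ (inj₂ refl) = ¬Px (subst P (det Pa (symmetric Exx′)) Pa)

    twins : ∀ {z} → z ≢ x → z ≢ x′ → adj G x z ≡ adj G x′ z
    twins {z} z≢x z≢x′ with P? z
    ... | yes Pz = same-adj Exx′ (det Pz)
    -- Compare `z` with its preimage under `g`: `similar` exchanges `x` for the determined `a`, to
    -- which both are adjacent in the same way.
    ... | no ¬Pz with g , ext ← extend Exx′
      with adj≡ , eq , Ew ← ext (from g z) rewrite strictlyInverseˡ g z = begin
        adj G x z           ≡⟨ sym G x z ⟩
        adj G z x           ≡⟨ similar ¬Pz z≢x ⟨
        adj G z a           ≡⟨ same-adj Ew (det Pa) ⟨
        adj G (from g z) a  ≡⟨ similar ¬Pw (λ w≡x → z≢x′ (≡-sym (eq (≡-sym w≡x)))) ⟩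
        adj G (from g z) x  ≡⟨ sym G _ _ ⟩
        adj G x (from g z)  ≡⟨ adj≡ ⟩
        adj G x′ z          ∎
      where
      open ≡-Reasoning
      ¬Pw : ¬ P (from g z)
      ¬Pw Pw = ¬Pz (subst P (det Pw Ew) Pw)

    toX : ∀ {z s} → ¬ (z ≡ x ⊎ z ≡ x′) → s ≡ x ⊎ s ≡ x′ → adj G z s ≡ adj G z x
    toX z∉ (inj₁ refl) = refl
    toX z∉ (inj₂ refl) = trans (sym G _ _)
      (trans (≡-sym (twins (z∉ ∘ inj₁) (z∉ ∘ inj₂))) (sym G _ _))

  -- Determined vertices along a contraction sequence

  module _ (prime : Prime G) {k : ℕ} {p : V G → Fin (suc k)} {q : V G → Fin k}
           (merge : Merge G p q) (width : Width≤ G q 1) where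

    private
      coarsens : ∀ {u v} → p u ≡ p v → q u ≡ q v
      coarsens = Merge-coarsens {G} {p = p} {q} merge

      classes : ∀ {r x} → p r ≢ p x → q r ≡ q x → ∀ {u v} → q u ≡ q v →
                p u ≡ p v ⊎ (p u ≡ p r × p v ≡ p x) ⊎ (p u ≡ p x × p v ≡ p r)
      classes = Merge-classes {G} {p = p} {q} merge

    -- The part of `b` already takes the only red edge of the enlarged part of `a`. Hence no further
    -- vertex may tell `a` from an absorbed `x`, and `twin-determined` applies.
    absorbed-determined :
      ∀ {a b} → Width≤ G p 1 → Red G p a b → q a ≢ q b →
      (∀ {x} → p x ≡ p a → Det x) → (∀ {x} → p x ≡ p b → Det x) →
      ∀ {x} → q x ≡ q a → Det x
    absorbed-determined {a} {b} widthp ab a≢b detA detB {x} x~a with p x ≟ p a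
    ... | yes x∈a = detA x∈a
    ... | no  x∉a = twin-determined prime (λ w → (p w ≟ p a) ⊎-dec (p w ≟ p b))
                      [ detA , detB ]′ (inj₁ refl) [ x∉a , x∉b ]′ similar
      where
      x∉b : p x ≢ p b
      x∉b e = a≢b (trans (≡-sym x~a) (coarsens e))

      far : ∀ {z w} → p z ≢ p a → p z ≢ p w → p z ≢ p x → q z ≢ q w
      far z∉a z∉w z∉x e with classes (x∉a ∘ ≡-sym) (≡-sym x~a) e
      ... | inj₁ h = z∉w h
      ... | inj₂ (inj₁ (h , _)) = z∉a h
      ... | inj₂ (inj₂ (h , _)) = z∉x h

      no-other-red : ∀ {z} → p z ≢ p a → p z ≢ p b → p z ≢ p x → ¬ Red G q a z
      no-other-red z∉a z∉b z∉x az =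
        far z∉a z∉b z∉x (Red-unique width az (Red-coarsen coarsens a≢b ab))

      -- A larger part of `x` would have a red neighbour in `p`. It differs from the parts of `a`
      -- and `b`, which are each other's only red neighbours, so after the merge it would be a
      -- second one beside `b`.
      singleton : ∀ {y} → p y ≡ p x → y ≡ x
      singleton {y} y∈x = decidable-stable (y ≟ x) λ y≢x →
        let z , xz = prime⇒Red prime (y≢x ∘ ≡-sym) y∈x (x∉a ∘ ≡-sym)
            z∉a = λ e → x∉b (Red-unique widthp (Red-sym (Red-respʳ e xz)) ab)
            z∉b = λ e → x∉a (Red-unique widthp (Red-sym (Red-respʳ e xz)) (Red-sym ab))
            z∉x = Red.apart xz ∘ ≡-sym
        in no-other-red z∉a z∉b z∉x
             (Red-respˡ x~a (Red-coarsen coarsens (far z∉a z∉x z∉x ∘ ≡-sym) xz))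

      similar : ∀ {y} → ¬ (p y ≡ p a ⊎ p y ≡ p b) → y ≢ x → adj G y a ≡ adj G y x
      similar {y} y∉ y≢x = decidable-stable (_ Bool.≟ _) λ differ →
        no-other-red (y∉ ∘ inj₁) (y∉ ∘ inj₂) (y≢x ∘ singleton)
          (Red-sym (mkRed (far (y∉ ∘ inj₁) (y∉ ∘ inj₁) (y≢x ∘ singleton)) refl refl refl x~a differ))

    -- Unless the joined part is everything, a splitter `z` gives its red edge, and the part of `z`
    -- is a singleton. The hypotheses on red neighbours cover both the two ends of a red edge and
    -- the first merge, before which there are no red edges.
    join-determined :
      ∀ {a b} → p a ≢ p b → q a ≡ q b →
      (∀ {z} → Red G p a z → p z ≡ p b) → (∀ {z} → Red G p b z → p z ≡ p a) →
      (∀ {x} → p x ≡ p a → Det x) → (∀ {x} → p x ≡ p b → Det x) →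
      (∀ x → Det x) ⊎
      ∃[ z ] (Red G q a z × (∀ {x} → q x ≡ q a → Det x) × (∀ {x} → q x ≡ q z → Det x))
    join-determined {a} {b} a≢b a~b redA redB detA detB with any? (λ y → ¬? (q y ≟ q a))
    ... | no  full = inj₁ λ x → detAB (decidable-stable (q x ≟ q a) λ x∉ → full (x , x∉))
      where
      detAB : ∀ {x} → q x ≡ q a → Det x
      detAB x~a with classes a≢b a~b x~a
      ... | inj₁ h = detA h
      ... | inj₂ (inj₁ (h , _)) = detA h
      ... | inj₂ (inj₂ (h , _)) = detB h
    ... | yes (y₀ , y₀∉)
      with z , s , t , z∉ , s∈ , t∈ , differ ←
             splitter {G} prime (λ w → q w ≟ q a) (a≢b ∘ cong p) refl (≡-sym a~b) y₀∉
      = inj₂ (z , az z∉ differ , detAB , λ x~z → subst Det (≡-sym (singleton x~z)) det-z)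
      where
      detAB : ∀ {x} → q x ≡ q a → Det x
      detAB x~a with classes a≢b a~b x~a
      ... | inj₁ h = detA h
      ... | inj₂ (inj₁ (h , _)) = detA h
      ... | inj₂ (inj₂ (h , _)) = detB h

      az : ∀ {z} → q z ≢ q a → adj G z s ≢ adj G z t → Red G q a z
      az z∉ differ = Red-sym (mkRed z∉ refl s∈ refl t∈ differ)

      outside : ∀ {y w} → p y ≢ p a → p y ≢ p b → q y ≡ q w → p y ≡ p w
      outside y∉a y∉b e with classes a≢b a~b e
      ... | inj₁ h = h
      ... | inj₂ (inj₁ (h , _)) = contradiction h y∉a
      ... | inj₂ (inj₂ (h , _)) = contradiction h y∉b

      z∉a : p z ≢ p a
      z∉a = z∉ ∘ coarsens

      z∉b : p z ≢ p b
      z∉b e = z∉ (trans (coarsens e) (≡-sym a~b))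

      singleton : ∀ {z′} → q z′ ≡ q z → z′ ≡ z
      singleton {z′} z′~z = decidable-stable (z′ ≟ z) λ z′≢z →
        let y , zy = prime⇒Red prime (z′≢z ∘ ≡-sym) (≡-sym (outside z∉a z∉b (≡-sym z′~z))) (z∉a ∘ ≡-sym)
            y∉a = λ e → z∉b (redA (Red-sym (Red-respʳ e zy)))
            y∉b = λ e → z∉a (redB (Red-sym (Red-respʳ e zy)))
            qzy = Red-coarsen coarsens (Red.apart zy ∘ outside z∉a z∉b) zy
        in y∉a (outside y∉a y∉b (Red-unique width qzy (Red-sym (az z∉ differ))))

      -- A vertex of the same colour as `z` also tells the determined `s` and `t` apart, so it lies
      -- in the unique red neighbour of the joined part, which is the singleton of `z`.
      det-z : Det z
      det-z {z′} Ezz′ = ≡-sym (singleton (≡-sym (Red-unique width (az z∉ differ) (az z′∉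
        λ e → differ (trans (same-adj Ezz′ (detAB s∈)) (trans e (≡-sym (same-adj Ezz′ (detAB t∈)))))))))
        where
        z′∉ : q z′ ≢ q a
        z′∉ h = z∉ (subst (λ w → q w ≡ q a) (detAB h (symmetric Ezz′)) h)

  -- Induction along the sequence; the invariant is a red edge both of whose ends consist of
  -- determined vertices. A merge keeping the ends apart preserves the edge, and one joining them
  -- finishes or supplies a new edge.
  red-edge-determines : Prime G → ∀ {k} {p : V G → Fin k} → Seq G 1 k p → Width≤ G p 1 →
                        ∀ {a b} → Red G p a b →
                        (∀ {x} → p x ≡ p a → Det x) → (∀ {x} → p x ≡ p b → Det x) → ∀ x → Det x
  red-edge-determines prime (end p k≤1) _ ab detA detB = contradiction (Fin≤1 k≤1 _ _) (Red.apart ab)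
  red-edge-determines prime (step p q merge width rest) widthp {a} {b} ab detA detB with q a ≟ q b
  ... | no  a≢b = red-edge-determines prime rest width
        (Red-coarsen (Merge-coarsens {G} {p = p} {q} merge) a≢b ab)
        (absorbed-determined prime merge width widthp ab a≢b detA detB)
        (absorbed-determined prime merge width widthp (Red-sym ab) (a≢b ∘ ≡-sym) detB detA)
  ... | yes a~b with join-determined prime merge width (Red.apart ab) a~b
                       (λ az → Red-unique widthp az ab) (λ bz → Red-unique widthp bz (Red-sym ab)) detA detB
  ...   | inj₁ done = done
  ...   | inj₂ (z , az , detAB , detZ) = red-edge-determines prime rest width az detAB detZ

-- u and v are the first two vertices merged.
prime-tww1-base : ∀ {G} → Prime G → TwinWidth≤ G 1 → V G →
                  ∃[ u ] ∃[ v ] (∀ {E} → Equitable G u v E → ∀ x → Determined E x)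
prime-tww1-base {G} prime seq o = go seq (λ i → i) (λ _ → refl) (λ _ → refl)
  where
  -- Generalising the identity labelling to `p` allows matching on `Seq`; the inverse `s` records
  -- that all parts are singletons.
  go : ∀ {k} {p : V G → Fin k} → Seq G 1 k p → (s : Fin k → V G) →
       (∀ i → p (s i) ≡ i) → (∀ x → s (p x) ≡ x) →
       ∃[ u ] ∃[ v ] (∀ {E} → Equitable G u v E → ∀ x → Determined E x)
  -- With at most one part there is at most one vertex, so `o` serves as both.
  go (end p k≤1) s ps sp = o , o , λ _ x {x′} _ →
    trans (≡-sym (sp x)) (trans (cong s (Fin≤1 k≤1 (p x) (p x′))) (sp x′))
  go (step p q merge@(c , d , c≢d , iff) width rest) s ps sp =
    s c , s d , λ {E} equitable → finish equitable
      (join-determined equitable prime merge width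
        (λ e → c≢d (trans (≡-sym (ps c)) (trans e (ps d))))
        (Equivalence.from (iff (s c) (s d)) (inj₂ (inj₁ (ps c , ps d))))
        (λ r → contradiction r no-red) (λ r → contradiction r no-red)
        (λ e → subst (Determined E) (≡-sym (injective e)) (Equitable.determined-u equitable))
        (λ e → subst (Determined E) (≡-sym (injective e)) (Equitable.determined-v equitable)))
    where
    injective : ∀ {x y} → p x ≡ p y → x ≡ y
    injective e = trans (≡-sym (sp _)) (trans (cong s e) (sp _))

    no-red : ∀ {a b} → ¬ Red G p a b
    no-red (mkRed _ x∈ y∈ x′∈ y′∈ differ) =
      differ (cong₂ (adj G) (injective (trans x∈ (≡-sym x′∈))) (injective (trans y∈ (≡-sym y′∈))))

    finish : ∀ {E a} → Equitable G (s c) (s d) E →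
             (∀ x → Determined E x) ⊎
             ∃[ z ] (Red G q a z × (∀ {x} → q x ≡ q a → Determined E x)
                                 × (∀ {x} → q x ≡ q z → Determined E x)) →
             ∀ x → Determined E x
    finish equitable (inj₁ done) = done
    finish equitable (inj₂ (z , az , detAB , detZ)) =
      red-edge-determines equitable prime rest width az detAB detZ

-- Decidability and stabilisation of Weisfeiler-Leman

_⇔-dec_ : ∀ {A B : Set} → Dec A → Dec B → Dec (A ⇔ B)
a? ⇔-dec b? = map′ (λ (f , g) → mk⇔ f g) (λ e → Equivalence.to e , Equivalence.from e)
                   ((a? →-dec b?) ×-dec (b? →-dec a?))

cons : ∀ {m k} → Fin k → (Fin m → Fin k) → Fin (suc m) → Fin k
cons i f zero    = i
cons i f (suc j) = f j

-- The enumerated functions agree with a given one only pointwise; `resp` takes the place of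
-- extensionality.
anyFun? : ∀ {m k} {P : (Fin m → Fin k) → Set} → (∀ {f g} → f ≗ g → P f → P g) →
          Decidable P → Dec (∃ P)
anyFun? {zero} resp P? = map′ (λ h → _ , h) (λ (f , h) → resp (λ ()) h) (P? λ ())
anyFun? {suc m} {P = P} resp P? =
  map′ (λ (i , f , h) → cons i f , h)
       (λ (f , h) → f zero , f ∘ suc , resp (λ { zero → refl ; (suc _) → refl }) h)
       (any? λ i → anyFun? (λ e → resp λ { zero → refl ; (suc j) → e j })
                          λ f → P? (cons i f))

any↔? : ∀ {m k} {P : Fin m → Fin k → Set} → (∀ i j → Dec (P i j)) →
        Dec (Σ (Fin m ↔ Fin k) λ f → ∀ i → P i (to f i))
any↔? {P = P} P? =
  map′ (λ (f , h , (g , inv)) → mk↔ₛ′ f g (proj₁ inv) (proj₂ inv) , h)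
       (λ (f , h) → to f , h , from f , strictlyInverseˡ f , strictlyInverseʳ f)
       (anyFun? (λ { e (h , g , gˡ , gʳ) → (λ i → subst (P i) (e i) (h i)) , g
                     , (λ j → trans (≡-sym (e (g j))) (gˡ j))
                     , (λ i → trans (cong g (≡-sym (e i))) (gʳ i)) })
         λ f → all? (λ i → P? i (f i)) ×-dec
           anyFun? (λ { e (gˡ , gʳ) → (λ j → trans (cong f (≡-sym (e j))) (gˡ j))
                                    , (λ i → trans (≡-sym (e (f i))) (gʳ i)) })
             λ g → all? (λ j → f (g j) ≟ j) ×-dec all? (λ i → g (f i) ≟ i))

SameAtp? : ∀ G H {m} (u : Vec (V G) m) (v : Vec (V H) m) → Dec (SameAtp G H u v)
SameAtp? G H u v =
  all? (λ i → _ ℕ.≟ _) ×-dec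
  all? (λ i → all? λ j → (_ ≟ _) ⇔-dec (_ ≟ _)) ×-dec
  all? (λ i → all? λ j → _ Bool.≟ _)

WLeq? : ∀ k i G H u v → Dec (WLeq k i G H u v)
WLeq? k zero    G H u v = SameAtp? G H u v
WLeq? k (suc i) G H u v = WLeq? k i G H u v ×-dec any↔? λ w w′ →
  SameAtp? G H (u ∷ʳ w) (v ∷ʳ w′) ×-dec all? λ j → WLeq? k i G H (u [ j ]≔ w) (v [ j ]≔ w′)

-- Filtering a list that covers `P i` by `P (suc i)` shortens it strictly unless all its entries
-- survive, and then the round is stable.
decreasing-stabilises :
  ∀ {A : Set} {P : ℕ → A → Set} → (∀ i → Decidable (P i)) → (∀ {i x} → P (suc i) x → P i x) →
  (xs : List A) → (∀ x → x ∈ xs) → ∃[ i ] (∀ x → P i x → P (suc i) x)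
decreasing-stabilises {A} {P} P? anti xs full = go 0 xs (<-wellFounded _) (λ _ → full _)
  where
  go : ∀ i ys → Acc _<_ (length ys) → (∀ {x} → P i x → x ∈ ys) → ∃[ i ] (∀ x → P i x → P (suc i) x)
  go i ys (acc rec) cover with All.all? (P? (suc i)) ys
  ... | yes all = i , λ x h → All.lookup all (cover h)
  ... | no ¬all = go (suc i) (filter (P? (suc i)) ys)
                    (rec (filter-notAll (P? (suc i)) ys (¬All⇒Any¬ (P? (suc i)) ys ¬all)))
                    (λ h → ∈-filter⁺ (P? (suc i)) (cover (anti h)) h)

allVecs : ∀ m k → List (Vec (Fin m) k)
allVecs m zero    = [] ∷ []
allVecs m (suc k) = cartesianProductWith _∷_ (allFin m) (allVecs m k)

∈-allVecs : ∀ {m k} (v : Vec (Fin m) k) → v ∈ allVecs m k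
∈-allVecs []      = here refl
∈-allVecs (x ∷ v) = ∈-cartesianProductWith⁺ _∷_ (∈-allFin x) (∈-allVecs v)

-- Pairs of tuples tagged with their graphs form one finite set, so a single round works for all
-- four comparisons.
WL-stabilises : ∀ k G H → ∃[ i ] StableAt k i G H
WL-stabilises k G H =
  proj₁ stable , (λ u v → proj₂ stable (true , true , u , v))
               , (λ u v → proj₂ stable (true , false , u , v))
               , (λ u v → proj₂ stable (false , true , u , v))
               , (λ u v → proj₂ stable (false , false , u , v))
  where
  graph : Bool → CGraph
  graph b = if b then G else H

  Pair : Bool → Bool → Set
  Pair b c = Vec (V (graph b)) k × Vec (V (graph c)) k

  pairs : ∀ b c → List (Σ Bool λ b → Σ Bool (Pair b))
  pairs b c = map (λ uv → b , c , uv) (cartesianProduct (allVecs _ k) (allVecs _ k))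

  tuples : List (Σ Bool λ b → Σ Bool (Pair b))
  tuples = (pairs true true ++ pairs true false) ++ (pairs false true ++ pairs false false)

  ∈-pairs : ∀ b c uv → (b , c , uv) ∈ pairs b c
  ∈-pairs b c (u , v) = ∈-map⁺ _ (∈-cartesianProduct⁺ (∈-allVecs u) (∈-allVecs v))

  complete : ∀ t → t ∈ tuples
  complete (true  , true  , uv) = ∈-++⁺ˡ (∈-++⁺ˡ (∈-pairs true true uv))
  complete (true  , false , uv) = ∈-++⁺ˡ (∈-++⁺ʳ (pairs true true) (∈-pairs true false uv))
  complete (false , true  , uv) =
    ∈-++⁺ʳ (pairs true true ++ pairs true false) (∈-++⁺ˡ (∈-pairs false true uv))
  complete (false , false , uv) =
    ∈-++⁺ʳ (pairs true true ++ pairs true false) (∈-++⁺ʳ (pairs false true) (∈-pairs false false uv))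

  stable : ∃[ i ] (∀ ((b , c , u , v) : Σ Bool λ b → Σ Bool (Pair b)) →
                   WLeq k i (graph b) (graph c) u v → WLeq k (suc i) (graph b) (graph c) u v)
  stable = decreasing-stabilises (λ i (b , c , u , v) → WLeq? k i (graph b) (graph c) u v)
                                 proj₁ tuples complete

WLeq⇒SameAtp : ∀ {k} i {G H u v} → WLeq k i G H u v → SameAtp G H u v
WLeq⇒SameAtp zero    h       = h
WLeq⇒SameAtp (suc i) (h , _) = WLeq⇒SameAtp i h

-- The colouring read off from triples (u , v , x)

module _ {G H : CGraph} {i : ℕ} (stable : ∀ s t → WLeq 3 i G H s t → WLeq 3 (suc i) G H s t)
         (u v : V G) (u′ v′ : V H) where

  private
    R : V G → V H → Set
    R x y = WLeq 3 i G H (u ∷ v ∷ x ∷ []) (u′ ∷ v′ ∷ y ∷ [])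

    -- Equality of colours within `G` is expressed through a common partner in `H`, so only
    -- stability between `G` and `H` enters.
    Indistinct : V G → V G → Set
    Indistinct x x′ = ∃[ y ] (R x y × R x′ y)

    step-R : ∀ {x y} → R x y → Σ (V G ↔ V H) λ f → ∀ w →
             adj G x w ≡ adj H y (to f w) × (x ≡ w ⇔ y ≡ to f w) × R w (to f w)
    step-R Rxy with _ , f , ext ← stable _ _ Rxy = f , λ w →
      let (_ , equal , adjacent) , recolour = ext w
      -- Counting from 0, position 2 holds `x` and position 3 the appended `w`. Replacing position 2
      -- leaves `u` and `v` in place.
      in adjacent (# 2) (# 3) , equal (# 2) (# 3) , recolour (# 2)

    -- A partner `y` of `s` must be `s′`, and then every `x` related to `y` must be `s`.
    pinned : ∀ {s s′} → (∀ {x y} → R x y → s ≡ x ⇔ s′ ≡ y) → Determined Indistinct s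
    pinned fixed (y , Rsy , Rxy) = Equivalence.from (fixed Rxy) (Equivalence.to (fixed Rsy) refl)

  Indistinct-equitable : Equitable G u v Indistinct
  Indistinct-equitable = record
    { symmetric    = λ (y , Rxy , Rx′y) → y , Rx′y , Rxy
    ; extend       = extend
    ; determined-u = pinned λ Rxy → proj₁ (proj₂ (WLeq⇒SameAtp i Rxy)) (# 0) (# 2)
    ; determined-v = pinned λ Rxy → proj₁ (proj₂ (WLeq⇒SameAtp i Rxy)) (# 1) (# 2)
    }
    where
    extend : ∀ {x x′} → Indistinct x x′ → Σ (V G ↔ V G) λ g → ∀ w →
             adj G x w ≡ adj G x′ (to g w) × (x ≡ w → x′ ≡ to g w) × Indistinct w (to g w)
    -- Both bijections lead to `H`; going along `f` and back along `f′` makes `to f w` the common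
    -- partner of `w` and its image.
    extend (y , Rxy , Rx′y) with f , ext ← step-R Rxy | f′ , ext′ ← step-R Rx′y =
      ↔-sym f′ ↔-∘ f , λ w →
        let adj≡ , eq , Rw = ext w
            adj≡′ , eq′ , Rw′ = ext′ (from f′ (to f w))
            back = strictlyInverseˡ f′ (to f w)
        in trans adj≡ (≡-sym (trans adj≡′ (cong (adj H y) back)))
         , (λ x≡w → Equivalence.from eq′ (trans (Equivalence.to eq x≡w) (≡-sym back)))
         , to f w , Rw , subst (R _) back Rw′

  -- Discreteness makes `R` the graph of `φ`. The bijection obtained from any other related pair
  -- therefore agrees with `φ`, which yields adjacency at every vertex.
  Indistinct-discrete⇒≅ : (∀ x → Determined Indistinct x) → ∀ {o y} → R o y → G ≅ H
  Indistinct-discrete⇒≅ discrete Roy with φ , ext ← step-R Roy = φ , adj-φ , col-φ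
    where
    Rφ : ∀ w → R w (to φ w)
    Rφ w = proj₂ (proj₂ (ext w))

    functional : ∀ {w y} → R w y → y ≡ to φ w
    functional {w} {y} Rwy =
      let e = strictlyInverseˡ φ y
      in trans (≡-sym e) (cong (to φ) (≡-sym (discrete w (y , Rwy , subst (R _) e (Rφ (from φ y))))))

    adj-φ : ∀ x w → adj H (to φ x) (to φ w) ≡ adj G x w
    adj-φ x w with f , ext′ ← step-R (Rφ x) with adj≡ , _ , Rw ← ext′ w =
      ≡-sym (trans adj≡ (cong (adj H (to φ x)) (functional Rw)))

    col-φ : ∀ x → col H (to φ x) ≡ col G x
    col-φ x = ≡-sym (proj₁ (WLeq⇒SameAtp i (Rφ x)) (# 2))

-- From equal multisets of stable colours to isomorphism

stable-SameMultiset⇒≅ : ∀ {G H i} → Prime G → TwinWidth≤ G 1 →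
                        (∀ s t → WLeq 3 i G H s t → WLeq 3 (suc i) G H s t) →
                        SameMultiset 3 i G H → ¬ ¬ (G ≅ H)
stable-SameMultiset⇒≅ {G} {H} {i} prime tww stable (g , same) G≇H =
  -- Any vertex of `G` would lead to an isomorphism, so both graphs are empty, and then the empty
  -- map is one.
  G≇H (mk↔ₛ′ (λ x → contradiction x ¬VG) (λ y → contradiction y ¬VH)
             (λ y → contradiction y ¬VH) (λ x → contradiction x ¬VG)
      , (λ x → contradiction x ¬VG) , (λ x → contradiction x ¬VG))
  where
  ¬VG : ¬ V G
  ¬VG o
    with u , v , discrete ← prime-tww1-base prime tww o
    -- The third entry only supplies a first related pair; `u` is an arbitrary choice.
    with to g (u ∷ v ∷ u ∷ []) | same (u ∷ v ∷ u ∷ [])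
  ... | u′ ∷ v′ ∷ y ∷ [] | Ruy =
    G≇H (Indistinct-discrete⇒≅ {G} {H} {i} stable u v u′ v′
          (discrete (Indistinct-equitable {G} {H} {i} stable u v u′ v′)) {u} {y} Ruy)

  ¬VH : ¬ V H
  ¬VH y = ¬VG (head (from g (y ∷ y ∷ y ∷ [])))

theorem4p6 : (G H : CGraph) → Prime G → Prime H →
    TwinWidth≤ G 1 → TwinWidth≤ H 1 → ¬ (G ≅ H) → WLDistinguishes 3 G H
theorem4p6 G H primeG _ twwG _ G≇H with i , stable ← WL-stabilises 3 G H =
  i , stable , λ same → stable-SameMultiset⇒≅ {G} {H} {i} primeG twwG (proj₁ (proj₂ stable)) same G≇H
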